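{- For any $\lambda,k\in\mathbb{N}$ such that $\lambda$ is odd and $k\ge4$, there exists a scroll $\mathcal{S}$ on $n=k\lambda$ vertices such that the period of its sum vector $\vec\Sigma(\mathcal{S})$ is $\lambda$.
   Context: Let $\mathcal{C}_n$ be the cycle graph on $\mathbb{Z}_n=\{1,\dots,n\}$ with edges $\{i,i+1\}$ (mod $n$). Independent sets are binary vectors $x\in\{0,1\}^n$ with no two cyclically adjacent $1$s. The toggle $\tau_k$ changes $x_k$ from $1$ to $0$, from $0$ to $1$ if the result is independent, and otherwise does nothing; $\tau=\tau_n\circ\cdots\circ\tau_1$, $x^{(i)}=\tau^i(x)$. A scroll on $n$ vertices is the array whose $i$-th row ($i\in\mathbb{Z}$) is $x^{(i)}$ for some independent set $x$ of $\mathcal{C}_n$; its period $T$ is the least $m>0$ with $x^{(m)}=x$. Its sum vector $\vec\Sigma(\mathcal{S})\in\mathbb{N}^n$ is the vector of column sums of the table with rows $x^{(0)},\dots,x^{(T-1)}$, and its period is its period as a cyclic word: the least $\lambda>0$ with $\Sigma_{j+\lambda}=\Sigma_j$ for all $j$ (indices mod $n$). -}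

module Defs where

open import Data.Nat using (ℕ; zero; suc; _+_; _*_; _∸_; _<_; _≤_)
open import Data.Nat.DivMod using (_%_; m%n<n)
open import Data.Bool using (Bool; true; false; not; _∧_; if_then_else_)
open import Data.Fin using (Fin; toℕ; fromℕ<)
open import Data.Vec using (Vec; lookup; _[_]≔_)
open import Data.List using (List; foldl; allFin; map; upTo)
open import Data.Nat.ListAction using (sum)
open import Data.Product using (_×_)
open import Relation.Binary.PropositionalEquality using (_≡_)
open import Function using (_∘_)

-- Configurations on the cycle C_n: vertices are 0,…,n-1 (paper's vertex i is our i-1).
Config : ℕ → Set
Config n = Vec Bool n

get : ∀ {n} → Config n → ℕ → Bool
get {zero}  _ _ = false
get {suc n} x j = lookup x (fromℕ< (m%n<n j (suc n)))

Independent : ∀ {n} → Config n → Set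
Independent {n} x = (i : Fin n) → (get x (toℕ i) ∧ get x (toℕ i + 1)) ≡ false

toggle : ∀ {n} → Fin n → Config n → Config n
toggle {n} k x with lookup x k
... | true  = x [ k ]≔ false
... | false = x [ k ]≔ (not (get x (toℕ k + (n ∸ 1))) ∧ not (get x (toℕ k + 1)))

tau : ∀ {n} → Config n → Config n
tau {n} x = foldl (λ y k → toggle k y) x (allFin n)

tauIter : ∀ {n} → ℕ → Config n → Config n
tauIter zero    x = x
tauIter (suc i) x = tau (tauIter i x)

IsScrollPeriod : ∀ {n} → Config n → ℕ → Set
IsScrollPeriod x T =
  (0 < T) × (tauIter T x ≡ x) × ((m : ℕ) → 0 < m → tauIter m x ≡ x → T ≤ m)

sumVec : ∀ {n} → Config n → ℕ → ℕ → ℕ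
sumVec x T j = sum (map (λ i → if get (tauIter i x) j then 1 else 0) (upTo T))

IsCyclicPeriod : (n : ℕ) → (ℕ → ℕ) → ℕ → Set
IsCyclicPeriod n s l =
  (0 < l) × ((j : Fin n) → s (toℕ j + l) ≡ s (toℕ j))
  × ((m : ℕ) → 0 < m → ((j : Fin n) → s (toℕ j + m) ≡ s (toℕ j)) → l ≤ m)

module Submission where

-- Read row by row, a scroll on n vertices is a sequence y satisfying
-- y (m + n) = NOR (y m, y (m + 1), y (m + n - 1)). Put l = 2μ + 1, n = k l and
-- p = (l + 1) n - l. If z is p-periodic with
-- z (q + l + 1) = NOR (z q, z (q + 1), z (q + l + 2)), then y m = z ((l + 1) m)
-- is a scroll, because (l + 1) n = l modulo p. Every cyclic concatenation of
-- blocks (10)^(μ+1) 0^l and (10)^(μ+1) 0^(l+1) of total length p is such a z,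
-- and the j-th column sum over the p / l rows of a period counts the ones of z at
-- positions congruent to j modulo l, so it has period dividing l. The blocks can
-- be arranged so that the class of l - 1 is counted differently from all others.

-- A block starting at residue `c` modulo `l` has its ones in the classes `c`, `c + 2`, ...,
-- `c + 2μ`, so the column sums depend only on how the block starts are distributed modulo `l`.
-- Equidistributed starts would make the sum vector constant; the words are therefore
-- equidistributed arrangements with a defect that singles out one class. One class is enough,
-- because a shift by `0 < m < l` carries it onto another one. The bound on `k` comes from the
-- length: `a` short and `b` long blocks have total length `p` for `a = l`, `b = (k - 2) l / 2` if
-- `k` is even, and for `a = 2l + 1`, `b = ((k - 4) l - 1) / 2` if `k` is odd. The first choice
-- requires a long block to create the defect, the second requires `b` to be non-negative; together
-- this leaves `4 ≤ k`.

open import Defs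
open import Data.Bool using (Bool; true; false; not; _∧_; if_then_else_)
open import Data.Bool.Properties using (∧-zeroʳ; ∧-comm; not-involutive) renaming (_≟_ to _≟ᵇ_)
open import Data.Fin using (Fin; toℕ; fromℕ<) renaming (zero to fzero; suc to fsuc)
open import Data.Fin.Properties using (toℕ-fromℕ<; toℕ<n; toℕ-injective) renaming (_≟_ to _≟ᶠ_)
open import Data.List using (List; []; _∷_; _++_; applyUpTo; foldl; map; replicate)
  renaming (tabulate to tabulateˡ)
open import Data.List.Properties using (map-upTo)
open import Data.Nat
  using (ℕ; zero; suc; _+_; _*_; _∸_; _<_; _≤_; _≡ᵇ_; _<ᵇ_; z≤n; s≤s; s≤s⁻¹; z<s; NonZero; >-nonZero)
open import Data.Nat.DivMod
  using (_%_; _/_; m%n<n; m<n⇒m%n≡m; n%n≡0; [m+n]%n≡m%n; m≡m%n+[m/n]*n)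
open import Data.Nat.Induction using (<-rec)
open import Data.Nat.ListAction using (sum)
open import Data.Nat.Properties
open import Data.Nat.Tactic.RingSolver using (solve-∀)
open import Data.Product using (Σ; ∃; _×_; _,_)
open import Data.Sum using (_⊎_; inj₁; inj₂)
open import Data.Vec using (lookup; tabulate; _[_]≔_)
open import Data.Vec.Properties
  using (tabulate-cong; lookup∘tabulate; tabulate∘lookup; lookup∘update; lookup∘update′; ≡-dec)
open import Function using (_∘_)
open import Relation.Binary.PropositionalEquality
  using (_≡_; _≢_; refl; sym; trans; cong; cong₂; subst; module ≡-Reasoning)
open import Relation.Nullary using (Dec; yes; no; contradiction; _×-dec_)
open import Relation.Unary using (Decidable)

-- Finite sums

⟦_⟧ : Bool → ℕ
⟦ b ⟧ = if b then 1 else 0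

∑ : ℕ → (ℕ → ℕ) → ℕ
∑ n f = sum (applyUpTo f n)

∑-cong : ∀ n {f g} → (∀ i → i < n → f i ≡ g i) → ∑ n f ≡ ∑ n g
∑-cong zero    eq = refl
∑-cong (suc n) eq = cong₂ _+_ (eq 0 z<s) (∑-cong n λ i i<n → eq (suc i) (s≤s i<n))

∑-cong′ : ∀ n {f g} → (∀ i → f i ≡ g i) → ∑ n f ≡ ∑ n g
∑-cong′ n eq = ∑-cong n λ i _ → eq i

∑-split : ∀ m n f → ∑ (m + n) f ≡ ∑ m f + ∑ n (λ i → f (m + i))
∑-split zero    n f = refl
∑-split (suc m) n f = trans (cong (f 0 +_) (∑-split m n (f ∘ suc))) (sym (+-assoc (f 0) _ _))

∑-snoc : ∀ n f → ∑ (suc n) f ≡ ∑ n f + f n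
∑-snoc zero    f = +-identityʳ (f 0)
∑-snoc (suc n) f = trans (cong (f 0 +_) (∑-snoc n (f ∘ suc))) (sym (+-assoc (f 0) _ _))

∑-const : ∀ n c → ∑ n (λ _ → c) ≡ n * c
∑-const zero    c = refl
∑-const (suc n) c = cong (c +_) (∑-const n c)

∑-+ : ∀ n f g → ∑ n (λ i → f i + g i) ≡ ∑ n f + ∑ n g
∑-+ zero    f g = refl
∑-+ (suc n) f g = trans (cong ((f 0 + g 0) +_) (∑-+ n (f ∘ suc) (g ∘ suc)))
                        (interchange (f 0) (g 0) _ _)
  where
  interchange : ∀ a b c d → (a + b) + (c + d) ≡ (a + c) + (b + d)
  interchange = solve-∀

∑-swap : ∀ m n (f : ℕ → ℕ → ℕ) → ∑ m (λ i → ∑ n (f i)) ≡ ∑ n (λ j → ∑ m (λ i → f i j))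
∑-swap zero    n f = sym (trans (∑-const n 0) (*-zeroʳ n))
∑-swap (suc m) n f = trans (cong (∑ n (f 0) +_) (∑-swap m n (f ∘ suc)))
                           (sym (∑-+ n (f 0) (λ j → ∑ m (λ i → f (suc i) j))))

∑-mono : ∀ n {f g} → (∀ i → f i ≤ g i) → ∑ n f ≤ ∑ n g
∑-mono zero    f≤g = z≤n
∑-mono (suc n) f≤g = +-mono-≤ (f≤g 0) (∑-mono n (λ i → f≤g (suc i)))

term≤∑ : ∀ n f i → i < n → f i ≤ ∑ n f
term≤∑ (suc n) f zero    _         = m≤m+n (f 0) _
term≤∑ (suc n) f (suc i) (s≤s i<n) = ≤-trans (term≤∑ n (f ∘ suc) i i<n) (m≤n+m _ (f 0))

∑-blocks : ∀ h l f → ∑ (h * l) f ≡ ∑ h (λ i → ∑ l (λ s → f (i * l + s)))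
∑-blocks zero    l f = refl
∑-blocks (suc h) l f = trans (∑-split l (h * l) f) (cong (∑ l f +_)
  (trans (∑-blocks h l (λ i → f (l + i)))
         (∑-cong′ h λ i → ∑-cong′ l λ s → cong f (sym (+-assoc l (i * l) s)))))

∑-select : ∀ n (b : ℕ → ℕ) r → r < n → ∑ n (λ s → b s * ⟦ s ≡ᵇ r ⟧) ≡ b r
∑-select (suc n) b zero    _         =
  trans (cong₂ _+_ (*-identityʳ (b 0)) (trans (∑-cong′ n λ s → *-zeroʳ (b (suc s))) (trans (∑-const n 0) (*-zeroʳ n))))
        (+-identityʳ (b 0))
∑-select (suc n) b (suc r) (s≤s r<n) =
  trans (cong (_+ ∑ n (λ s → b (suc s) * ⟦ s ≡ᵇ r ⟧)) (*-zeroʳ (b 0))) (∑-select n (b ∘ suc) r r<n)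

-- Sums of periodic sequences

Periodic : {A : Set} → ℕ → (ℕ → A) → Set
Periodic l f = ∀ i → f (i + l) ≡ f i

periodic-* : {A : Set} {l : ℕ} {f : ℕ → A} → Periodic l f → ∀ c i → f (i + c * l) ≡ f i
periodic-* {f = f} per zero    i = cong f (+-identityʳ i)
periodic-* {l = l} {f} per (suc c) i =
  trans (cong f (sym (+-assoc i l (c * l)))) (trans (periodic-* per c (i + l)) (per i))

-- Moving the window by one place trades `f a` for `f (a + l)`, which is the same value. Adding
-- `f a` to both sides before cancelling avoids subtraction.
∑-shift : ∀ l f → Periodic l f → ∀ a → ∑ l (λ t → f (a + t)) ≡ ∑ l f
∑-shift l f per zero    = refl
∑-shift l f per (suc a) = trans (+-cancelˡ-≡ (f a) _ _ lemma) (∑-shift l f per a)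
  where
  open ≡-Reasoning
  lemma : f a + ∑ l (λ t → f (suc (a + t))) ≡ f a + ∑ l (λ t → f (a + t))
  lemma = begin
    f a + ∑ l (λ t → f (suc (a + t)))        ≡⟨ cong₂ _+_ (cong f (+-identityʳ a)) (∑-cong′ l λ t → cong f (+-suc a t)) ⟨
    ∑ (suc l) (λ t → f (a + t))              ≡⟨ ∑-snoc l _ ⟩
    ∑ l (λ t → f (a + t)) + f (a + l)        ≡⟨ cong (∑ l (λ t → f (a + t)) +_) (per a) ⟩
    ∑ l (λ t → f (a + t)) + f a              ≡⟨ +-comm _ (f a) ⟩
    f a + ∑ l (λ t → f (a + t))              ∎

∑-periods : ∀ c l f → Periodic l f → ∑ (c * l) f ≡ c * ∑ l f
∑-periods c l f per = trans (∑-blocks c l f)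
  (trans (∑-cong′ c λ i → ∑-shift l f per (i * l)) (∑-const c (∑ l f)))

-- Prepares `∑-double`: of the doubled indices modulo `2μ + 1`, the first `μ + 1` are the even
-- residues, and the other `μ` wrap around to the odd ones.
∑-interleave : ∀ μ f → ∑ (suc μ) (λ t → f (t * 2)) + ∑ μ (λ t → f (suc (t * 2))) ≡ ∑ (suc (μ * 2)) f
∑-interleave zero    f = +-identityʳ (f 0 + 0)
∑-interleave (suc μ) f =
  trans (rearrange (f 0) _ (f 1) _) (cong (λ s → f 0 + (f 1 + s)) (∑-interleave μ (λ t → f (2 + t))))
  where
  rearrange : ∀ a b c d → (a + b) + (c + d) ≡ a + (c + (b + d))
  rearrange = solve-∀

-- Doubling permutes the residues modulo an odd number.
∑-double : ∀ μ f → Periodic (suc (μ * 2)) f → ∀ a →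
           ∑ (suc (μ * 2)) (λ t → f (a + t * 2)) ≡ ∑ (suc (μ * 2)) f
∑-double μ f per a = begin
  ∑ (suc (μ * 2)) (λ t → f (a + t * 2))
    ≡⟨ cong (λ n → ∑ n (λ t → f (a + t * 2))) (halves μ) ⟩
  ∑ (suc μ + μ) (λ t → f (a + t * 2))
    ≡⟨ ∑-split (suc μ) μ (λ t → f (a + t * 2)) ⟩
  ∑ (suc μ) (λ t → f (a + t * 2)) + ∑ μ (λ t → f (a + (suc μ + t) * 2))
    ≡⟨ cong (∑ (suc μ) (λ t → f (a + t * 2)) +_)
            (∑-cong′ μ λ t → trans (cong f (wrap a μ t)) (per (a + suc (t * 2)))) ⟩
  ∑ (suc μ) (λ t → f (a + t * 2)) + ∑ μ (λ t → f (a + suc (t * 2)))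
    ≡⟨ ∑-interleave μ (λ t → f (a + t)) ⟩
  ∑ (suc (μ * 2)) (λ t → f (a + t))
    ≡⟨ ∑-shift _ f per a ⟩
  ∑ (suc (μ * 2)) f ∎
  where
  open ≡-Reasoning
  halves : ∀ μ → suc (μ * 2) ≡ suc μ + μ
  halves = solve-∀
  wrap : ∀ a μ t → a + (suc μ + t) * 2 ≡ a + suc (t * 2) + suc (μ * 2)
  wrap = solve-∀

-- Residue counts of words

residue : ℕ → ℕ → ℕ → ℕ
residue l r q = ⟦ (q % suc l) ≡ᵇ r ⟧

residue-periodic : ∀ l r → Periodic (suc l) (residue l r)
residue-periodic l r q = cong (λ t → ⟦ t ≡ᵇ r ⟧) ([m+n]%n≡m%n q (suc l))

≡ᵇ-refl : ∀ n → (n ≡ᵇ n) ≡ true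
≡ᵇ-refl zero    = refl
≡ᵇ-refl (suc n) = ≡ᵇ-refl n

≢⇒≡ᵇ-false : ∀ {m n} → m ≢ n → (m ≡ᵇ n) ≡ false
≢⇒≡ᵇ-false {zero}  {zero}  m≢n = contradiction refl m≢n
≢⇒≡ᵇ-false {zero}  {suc n} m≢n = refl
≢⇒≡ᵇ-false {suc m} {zero}  m≢n = refl
≢⇒≡ᵇ-false {suc m} {suc n} m≢n = ≢⇒≡ᵇ-false (λ m≡n → m≢n (cong suc m≡n))

residue-< : ∀ l r q → q < suc l → residue l r q ≡ ⟦ q ≡ᵇ r ⟧
residue-< l r q q<l = cong (λ t → ⟦ t ≡ᵇ r ⟧) (m<n⇒m%n≡m q<l)

∑-residue : ∀ l r → r < suc l → ∑ (suc l) (residue l r) ≡ 1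
∑-residue l r r<l = trans
  (∑-cong (suc l) λ q q<l → trans (residue-< l r q q<l) (sym (*-identityˡ ⟦ q ≡ᵇ r ⟧)))
  (∑-select (suc l) (λ _ → 1) r r<l)

-- The g-weight of the ones of a block (10)^(μ+1) 0 … 0 placed at c.
combSum : ℕ → (ℕ → ℕ) → ℕ → ℕ
combSum μ g c = ∑ (suc μ) (λ i → g (c + i * 2))

combSum-periodic : ∀ μ g l → Periodic l g → Periodic l (combSum μ g)
combSum-periodic μ g l per c = ∑-cong′ (suc μ) λ i → trans (cong g (swap c l (i * 2))) (per (c + i * 2))
  where
  swap : ∀ a b c → a + b + c ≡ a + c + b
  swap = solve-∀

module Residue (μ r : ℕ) (r<l : r < suc (μ * 2)) where

  open ≡-Reasoning

  l : ℕ
  l = suc (μ * 2)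

  g G : ℕ → ℕ
  g = residue (μ * 2) r
  G = combSum μ g

  g-periodic : Periodic l g
  g-periodic = residue-periodic (μ * 2) r

  G-periodic : Periodic l G
  G-periodic = combSum-periodic μ g l g-periodic

  -- Each of the `μ + 1` ones of a block falls into the class `r` for exactly one start `c` per
  -- round, which exchanging the two sums makes visible.
  ∑G≡1+μ : ∑ l G ≡ suc μ
  ∑G≡1+μ = begin
    ∑ l G                                             ≡⟨ ∑-swap l (suc μ) (λ c i → g (c + i * 2)) ⟩
    ∑ (suc μ) (λ i → ∑ l (λ c → g (c + i * 2)))       ≡⟨ ∑-cong′ (suc μ) full ⟩
    ∑ (suc μ) (λ _ → 1)                               ≡⟨ ∑-const (suc μ) 1 ⟩
    suc μ * 1                                         ≡⟨ *-identityʳ (suc μ) ⟩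
    suc μ                                             ∎
    where
    full : ∀ i → ∑ l (λ c → g (c + i * 2)) ≡ 1
    full i = begin
      ∑ l (λ c → g (c + i * 2))   ≡⟨ ∑-cong′ l (λ c → cong g (+-comm c (i * 2))) ⟩
      ∑ l (λ c → g (i * 2 + c))   ≡⟨ ∑-shift l g g-periodic (i * 2) ⟩
      ∑ l g                       ≡⟨ ∑-residue (μ * 2) r r<l ⟩
      1                           ∎

  ∑g-double : ∀ c → ∑ l (λ t → g (c + t * 2)) ≡ 1
  ∑g-double c = trans (∑-double μ g g-periodic c) (∑-residue (μ * 2) r r<l)

  ∑g-double-split : ∀ c → G c + ∑ μ (λ t → g (c + (suc μ + t) * 2)) ≡ 1
  ∑g-double-split c = begin
    G c + ∑ μ (λ t → g (c + (suc μ + t) * 2))   ≡⟨ ∑-split (suc μ) μ (λ t → g (c + t * 2)) ⟨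
    ∑ (suc μ + μ) (λ t → g (c + t * 2))         ≡⟨ cong (λ n → ∑ n (λ t → g (c + t * 2))) (halves μ) ⟨
    ∑ l (λ t → g (c + t * 2))                   ≡⟨ ∑g-double c ⟩
    1                                           ∎
    where
    halves : ∀ μ → suc (μ * 2) ≡ suc μ + μ
    halves = solve-∀

  -- The ones of a block are the beginning of a progression of step 2 and length `l`, which meets
  -- each class exactly once.
  G≤1 : ∀ c → G c ≤ 1
  G≤1 c = subst (G c ≤_) (∑g-double-split c) (m≤m+n (G c) _)

  -- The progressions from 0 and from μ * 2 together traverse all residues
  -- once, apart from μ * 2, which both contain.
  G-ends : G 0 + G (μ * 2) ≡ suc ⟦ μ * 2 ≡ᵇ r ⟧
  G-ends = begin
    G 0 + (g (μ * 2 + 0) + ∑ μ (λ t → g (μ * 2 + suc t * 2)))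
      ≡⟨ cong (G 0 +_) (cong₂ _+_ (cong g (+-identityʳ (μ * 2))) (∑-cong′ μ λ t → cong g (shift μ t))) ⟩
    G 0 + (g (μ * 2) + ∑ μ (λ t → g ((suc μ + t) * 2)))
      ≡⟨ rotate (G 0) (g (μ * 2)) _ ⟩
    (G 0 + ∑ μ (λ t → g ((suc μ + t) * 2))) + g (μ * 2)
      ≡⟨ cong₂ _+_ (∑g-double-split 0) (residue-< (μ * 2) r (μ * 2) ≤-refl) ⟩
    suc ⟦ μ * 2 ≡ᵇ r ⟧ ∎
    where
    shift : ∀ μ t → μ * 2 + suc t * 2 ≡ (suc μ + t) * 2
    shift = solve-∀
    rotate : ∀ a b c → a + (b + c) ≡ (a + c) + b
    rotate = solve-∀

  -- From the even start `i * 2` the progression reaches `μ * 2` after `μ ∸ i` steps, without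
  -- wrapping around.
  G-top : r ≡ μ * 2 → ∀ i → i ≤ μ → G (i * 2) ≡ 1
  G-top refl i i≤μ = ≤-antisym (G≤1 (i * 2))
    (subst (_≤ G (i * 2)) term≡1 (term≤∑ (suc μ) (λ j → g (i * 2 + j * 2)) (μ ∸ i) (s≤s (m∸n≤m μ i))))
    where
    term≡1 : g (i * 2 + (μ ∸ i) * 2) ≡ 1
    term≡1 = begin
      g (i * 2 + (μ ∸ i) * 2)   ≡⟨ cong g (*-distribʳ-+ 2 i (μ ∸ i)) ⟨
      g ((i + (μ ∸ i)) * 2)     ≡⟨ cong (λ t → g (t * 2)) (m+[n∸m]≡n i≤μ) ⟩
      g (μ * 2)                 ≡⟨ residue-< (μ * 2) r (μ * 2) ≤-refl ⟩
      ⟦ μ * 2 ≡ᵇ μ * 2 ⟧        ≡⟨ cong ⟦_⟧ (≡ᵇ-refl (μ * 2)) ⟩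
      1                         ∎

  G-ends-< : r < μ * 2 → G 0 + G (μ * 2) ≡ 1
  G-ends-< r<2μ = trans G-ends (cong (λ b → suc ⟦ b ⟧) (≢⇒≡ᵇ-false (λ eq → <⇒≢ r<2μ (sym eq))))

-- A Boolean e encodes the block (10)^(μ+1) 0^(l + ⟦ e ⟧), where l = 2μ + 1. Its
-- length is 1 + ⟦ e ⟧ modulo l, whence the step in weight.
blockLength : ℕ → Bool → ℕ
blockLength l e = ⟦ e ⟧ + (suc l + l)

wordLength : ℕ → List Bool → ℕ
wordLength l es = sum (map (blockLength l) es)

weight : ℕ → (ℕ → ℕ) → List Bool → ℕ → ℕ
weight l G []       c = 0
weight l G (e ∷ es) c = G c + weight l G es (c + suc ⟦ e ⟧)

weight-replicate : ∀ l G e m es c → weight l G (replicate m e ++ es) c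
                 ≡ ∑ m (λ t → G (c + t * suc ⟦ e ⟧)) + weight l G es (c + m * suc ⟦ e ⟧)
weight-replicate l G e zero    es c = cong (weight l G es) (sym (+-identityʳ c))
weight-replicate l G e (suc m) es c = begin
  G c + weight l G (replicate m e ++ es) (c + s)
    ≡⟨ cong (G c +_) (weight-replicate l G e m es (c + s)) ⟩
  G c + (∑ m (λ t → G (c + s + t * s)) + weight l G es (c + s + m * s))
    ≡⟨ +-assoc (G c) _ _ ⟨
  (G c + ∑ m (λ t → G (c + s + t * s))) + weight l G es (c + s + m * s)
    ≡⟨ cong₂ _+_ (cong₂ _+_ (cong G (sym (+-identityʳ c))) (∑-cong′ m λ t → cong G (+-assoc c s (t * s))))
                 (cong (weight l G es) (+-assoc c s (m * s))) ⟩
  ∑ (suc m) (λ t → G (c + t * s)) + weight l G es (c + suc m * s) ∎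
  where
  open ≡-Reasoning
  s = suc ⟦ e ⟧

wordLength-replicate : ∀ l e m es → wordLength l (replicate m e ++ es) ≡ m * blockLength l e + wordLength l es
wordLength-replicate l e zero    es = refl
wordLength-replicate l e (suc m) es =
  trans (cong (blockLength l e +_) (wordLength-replicate l e m es)) (sym (+-assoc (blockLength l e) _ _))

-- Modulo l the block starts of evenWord are equidistributed up to an additional
-- l - 1 and a missing 0, those of oddWord up to additional 0, 2, …, l - 1.
evenWord oddWord : ℕ → ℕ → List Bool
evenWord μ h = replicate (h * suc (μ * 2) + μ * 2) true ++ false ∷ true ∷ replicate (μ * 2) false ++ []
oddWord  μ h = replicate (h * suc (μ * 2) + μ) true ++ replicate (suc (2 * suc (μ * 2))) false ++ []

evenWord-length : ∀ μ h → let l = suc (μ * 2) in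
  l + wordLength l (evenWord μ h) ≡ suc l * ((4 + h * 2) * l)
evenWord-length μ h = trans
  (cong (l +_) (trans (wordLength-replicate l true (h * l + μ * 2) _)
    (cong (λ w → (h * l + μ * 2) * blockLength l true + (blockLength l false + (blockLength l true + w)))
          (wordLength-replicate l false (μ * 2) []))))
  (arith μ h)
  where
  l = suc (μ * 2)
  arith : ∀ μ h → suc (μ * 2) + ((h * suc (μ * 2) + μ * 2) * (1 + (suc (suc (μ * 2)) + suc (μ * 2)))
            + ((suc (suc (μ * 2)) + suc (μ * 2)) + ((1 + (suc (suc (μ * 2)) + suc (μ * 2)))
            + (μ * 2 * (suc (suc (μ * 2)) + suc (μ * 2)) + 0))))
          ≡ suc (suc (μ * 2)) * ((4 + h * 2) * suc (μ * 2))
  arith = solve-∀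

oddWord-length : ∀ μ h → let l = suc (μ * 2) in
  l + wordLength l (oddWord μ h) ≡ suc l * ((5 + h * 2) * l)
oddWord-length μ h = trans
  (cong (l +_) (trans (wordLength-replicate l true (h * l + μ) _)
    (cong ((h * l + μ) * blockLength l true +_) (wordLength-replicate l false (suc (2 * l)) []))))
  (arith μ h)
  where
  l = suc (μ * 2)
  arith : ∀ μ h → suc (μ * 2) + ((h * suc (μ * 2) + μ) * (1 + (suc (suc (μ * 2)) + suc (μ * 2)))
            + (suc (2 * suc (μ * 2)) * (suc (suc (μ * 2)) + suc (μ * 2)) + 0))
          ≡ suc (suc (μ * 2)) * ((5 + h * 2) * suc (μ * 2))
  arith = solve-∀

module WordWeight (μ r : ℕ) (r<l : r < suc (μ * 2)) where

  open Residue μ r r<l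
  open ≡-Reasoning

  ∑G-double : ∀ c → ∑ (c * l) (λ t → G (t * 2)) ≡ c * suc μ
  ∑G-double c = begin
    ∑ (c * l) (λ t → G (t * 2))   ≡⟨ ∑-periods c l (λ t → G (t * 2)) periodic ⟩
    c * ∑ l (λ t → G (t * 2))     ≡⟨ cong (c *_) (∑-double μ G G-periodic 0) ⟩
    c * ∑ l G                     ≡⟨ cong (c *_) ∑G≡1+μ ⟩
    c * suc μ                     ∎
    where
    double : ∀ t l → (t + l) * 2 ≡ t * 2 + 2 * l
    double = solve-∀
    periodic : Periodic l (λ t → G (t * 2))
    periodic t = trans (cong G (double t l)) (periodic-* G-periodic 2 (t * 2))

  -- With all `(h + 1) * l` long blocks first and the `l` short ones after them, the starts would
  -- form `h + 2` full rounds of residues. The word swaps the last long block with the first short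
  -- one, which moves only the second of these starts, from 0 back to `l - 1`. Hence the exchange of
  -- `G 0` for `G (μ * 2)`, with the former kept on the left to avoid subtraction.
  evenWord-weight : ∀ h → weight l G (evenWord μ h) 0 + G 0 ≡ suc (suc h) * suc μ + G (μ * 2)
  evenWord-weight h = begin
    weight l G (evenWord μ h) 0 + G 0
      ≡⟨ cong (_+ G 0) (weight-replicate l G true M _ 0) ⟩
    ∑ M F + (G (M * 2) + (G (M * 2 + 1) + weight l G (replicate (μ * 2) false ++ []) (M * 2 + 1 + 2))) + G 0
      ≡⟨ cong₂ (λ a b → ∑ M F + (F M + (a + b)) + G 0) second third ⟩
    ∑ M F + (F M + (G (μ * 2) + ∑ (μ * 2) (λ t → G (suc t)))) + G 0
      ≡⟨ regroup (∑ M F) (F M) (G (μ * 2)) _ (G 0) ⟩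
    (∑ M F + F M) + ∑ l G + G (μ * 2)
      ≡⟨ cong₂ (λ a b → a + b + G (μ * 2)) first ∑G≡1+μ ⟩
    suc h * suc μ + suc μ + G (μ * 2)
      ≡⟨ cong (_+ G (μ * 2)) (+-comm (suc h * suc μ) (suc μ)) ⟩
    suc (suc h) * suc μ + G (μ * 2) ∎
    where
    M = h * l + μ * 2
    F : ℕ → ℕ
    F t = G (t * 2)

    regroup : ∀ a b c d e → a + (b + (c + d)) + e ≡ (a + b) + (e + d) + c
    regroup = solve-∀

    first : ∑ M F + F M ≡ suc h * suc μ
    first = trans (sym (∑-snoc M F)) (trans (cong (λ n → ∑ n F) (length μ (h * l))) (∑G-double (suc h)))
      where
      length : ∀ μ n → suc (n + μ * 2) ≡ suc (μ * 2) + n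
      length = solve-∀

    second : G (M * 2 + 1) ≡ G (μ * 2)
    second = trans (cong G (shift μ h)) (periodic-* G-periodic (h * 2 + 1) (μ * 2))
      where
      shift : ∀ μ h → (h * suc (μ * 2) + μ * 2) * 2 + 1 ≡ μ * 2 + (h * 2 + 1) * suc (μ * 2)
      shift = solve-∀

    third : weight l G (replicate (μ * 2) false ++ []) (M * 2 + 1 + 2) ≡ ∑ (μ * 2) (λ t → G (suc t))
    third = trans (weight-replicate l G false (μ * 2) [] (M * 2 + 1 + 2)) (trans (+-identityʳ _)
      (∑-cong′ (μ * 2) λ t → trans (cong G (shift μ h t)) (periodic-* G-periodic (h * 2 + 2) (suc t))))
      where
      shift : ∀ μ h t → (h * suc (μ * 2) + μ * 2) * 2 + 1 + 2 + t * 1 ≡ suc t + (h * 2 + 2) * suc (μ * 2)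
      shift = solve-∀

  -- The long blocks start at `h` full rounds of residues and then at 0, 2, ..., `2μ - 2`; the short
  -- ones start at `2μ` and then at two full rounds. What exceeds the rounds is 0, 2, ..., `2μ`.
  oddWord-weight : ∀ h → weight l G (oddWord μ h) 0 ≡ suc (suc h) * suc μ + ∑ (suc μ) (λ t → G (t * 2))
  oddWord-weight h = begin
    weight l G (oddWord μ h) 0
      ≡⟨ weight-replicate l G true (h * l + μ) _ 0 ⟩
    ∑ (h * l + μ) F + weight l G (replicate (suc (2 * l)) false ++ []) ((h * l + μ) * 2)
      ≡⟨ cong₂ _+_ first second ⟩
    (h * suc μ + ∑ μ F) + (F μ + 2 * suc μ)
      ≡⟨ regroup (h * suc μ) (∑ μ F) (F μ) (suc μ) ⟩
    suc (suc h) * suc μ + (∑ μ F + F μ)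
      ≡⟨ cong (suc (suc h) * suc μ +_) (∑-snoc μ F) ⟨
    suc (suc h) * suc μ + ∑ (suc μ) F ∎
    where
    F : ℕ → ℕ
    F t = G (t * 2)

    regroup : ∀ a b c d → (a + b) + (c + 2 * d) ≡ d + (d + a) + (b + c)
    regroup = solve-∀

    first : ∑ (h * l + μ) F ≡ h * suc μ + ∑ μ F
    first = trans (∑-split (h * l) μ F) (cong₂ _+_ (∑G-double h)
      (∑-cong′ μ λ t → trans (cong G (shift h l t)) (periodic-* G-periodic (h * 2) (t * 2))))
      where
      shift : ∀ h l t → (h * l + t) * 2 ≡ t * 2 + h * 2 * l
      shift = solve-∀

    second : weight l G (replicate (suc (2 * l)) false ++ []) ((h * l + μ) * 2) ≡ F μ + 2 * suc μ
    second = begin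
      weight l G (replicate (suc (2 * l)) false ++ []) ((h * l + μ) * 2)
        ≡⟨ trans (weight-replicate l G false (suc (2 * l)) [] ((h * l + μ) * 2)) (+-identityʳ _) ⟩
      ∑ (suc (2 * l)) (λ t → G ((h * l + μ) * 2 + t * 1))
        ≡⟨ ∑-cong′ (suc (2 * l)) (λ t → trans (cong G (shift μ h l t)) (periodic-* G-periodic (h * 2) (μ * 2 + t))) ⟩
      G (μ * 2 + 0) + ∑ (2 * l) (λ t → G (μ * 2 + suc t))
        ≡⟨ cong₂ _+_ (cong G (+-identityʳ (μ * 2)))
             (trans (∑-periods 2 l (λ t → G (μ * 2 + suc t))
                       (λ t → trans (cong G (sym (+-assoc (μ * 2) (suc t) l))) (G-periodic (μ * 2 + suc t))))
                    (cong (2 *_) (trans (∑-cong′ l λ t → cong G (+-suc (μ * 2) t))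
                                        (trans (∑-shift l G G-periodic l) ∑G≡1+μ)))) ⟩
      F μ + 2 * suc μ ∎
      where
      shift : ∀ μ h l t → (h * l + μ) * 2 + t * 1 ≡ μ * 2 + t + h * 2 * l
      shift = solve-∀

  oddWord-tail-top : r ≡ μ * 2 → ∑ (suc μ) (λ t → G (t * 2)) ≡ suc μ
  oddWord-tail-top top = trans (∑-cong (suc μ) λ { t (s≤s t≤μ) → G-top top t t≤μ })
                               (trans (∑-const (suc μ) 1) (*-identityʳ (suc μ)))

-- Every term is at most 1, and by `G-ends-<` the first and the last term share a single unit, so
-- the maximum `μ + 1` is missed.
oddWord-tail-< : ∀ μ r (r<l : r < suc (μ * 2)) → r < μ * 2 →
                 ∑ (suc μ) (λ t → combSum μ (residue (μ * 2) r) (t * 2)) < suc μ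
oddWord-tail-< (suc μ) r r<l r<2μ = s≤s (begin
  ∑ (2 + μ) F                                       ≡⟨ cong (F 0 +_) (∑-snoc μ (F ∘ suc)) ⟩
  F 0 + (∑ μ (F ∘ suc) + F (suc μ))                 ≡⟨ rotate (F 0) _ (F (suc μ)) ⟩
  (F 0 + F (suc μ)) + ∑ μ (F ∘ suc)                 ≡⟨ cong (_+ ∑ μ (F ∘ suc)) (G-ends-< r<2μ) ⟩
  1 + ∑ μ (F ∘ suc)                                 ≤⟨ s≤s (∑-mono μ λ t → G≤1 (suc t * 2)) ⟩
  1 + ∑ μ (λ _ → 1)                                 ≡⟨ cong suc (trans (∑-const μ 1) (*-identityʳ μ)) ⟩
  suc μ                                             ∎)
  where
  open Residue (suc μ) r r<l
  open ≤-Reasoning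
  F : ℕ → ℕ
  F t = G (t * 2)
  rotate : ∀ a b c → a + (b + c) ≡ (a + c) + b
  rotate = solve-∀

-- Separation of the top residue class

residueWeight : ℕ → List Bool → ℕ → ℕ
residueWeight μ es r = weight (suc (μ * 2)) (combSum μ (residue (μ * 2) r)) es 0

SeparatesTop : ℕ → List Bool → Set
SeparatesTop μ es = ∀ r → r < μ * 2 → residueWeight μ es r ≢ residueWeight μ es (μ * 2)

-- At the top class `G 0` and `G (μ * 2)` are both 1 and the defect cancels. At any other class
-- exactly one of them is 1, so the weight is off by one; formally, equal weights would make the two
-- agree while their sum is odd.
evenWord-separatesTop : ∀ μ h → SeparatesTop μ (evenWord μ h)
evenWord-separatesTop μ h r r<2μ eq = two≢odd (G 0) (begin
  2 * G 0            ≡⟨ cong (G 0 +_) (+-identityʳ (G 0)) ⟩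
  G 0 + G 0          ≡⟨ cong (G 0 +_) ends-agree ⟩
  G 0 + G (μ * 2)    ≡⟨ G-ends-< r<2μ ⟩
  1                  ∎)
  where
  open ≡-Reasoning
  r<l = m≤n⇒m≤1+n r<2μ
  open Residue μ r r<l
  module Top = Residue μ (μ * 2) ≤-refl
  K = suc (suc h) * suc μ
  top : residueWeight μ (evenWord μ h) (μ * 2) ≡ K
  top = +-cancelʳ-≡ 1 _ _ (begin
    residueWeight μ (evenWord μ h) (μ * 2) + 1         ≡⟨ cong (residueWeight μ (evenWord μ h) (μ * 2) +_) (Top.G-top refl 0 z≤n) ⟨
    residueWeight μ (evenWord μ h) (μ * 2) + Top.G 0   ≡⟨ WordWeight.evenWord-weight μ (μ * 2) ≤-refl h ⟩
    K + Top.G (μ * 2)                                  ≡⟨ cong (K +_) (Top.G-top refl μ ≤-refl) ⟩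
    K + 1                                              ∎)
  ends-agree : G 0 ≡ G (μ * 2)
  ends-agree = +-cancelˡ-≡ K _ _ (begin
    K + G 0                                   ≡⟨ cong (_+ G 0) (trans eq top) ⟨
    residueWeight μ (evenWord μ h) r + G 0    ≡⟨ WordWeight.evenWord-weight μ r r<l h ⟩
    K + G (μ * 2)                             ∎)
  two≢odd : ∀ n → 2 * n ≢ 1
  two≢odd (suc (suc n)) ()
  two≢odd (suc zero)    ()

oddWord-separatesTop : ∀ μ h → SeparatesTop μ (oddWord μ h)
oddWord-separatesTop μ h r r<2μ eq = <⇒≢ (oddWord-tail-< μ r r<l r<2μ) (+-cancelˡ-≡ (suc (suc h) * suc μ) _ _
  (trans (sym (WordWeight.oddWord-weight μ r r<l h))
  (trans eq
  (trans (WordWeight.oddWord-weight μ (μ * 2) ≤-refl h)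
         (cong (suc (suc h) * suc μ +_) (WordWeight.oddWord-tail-top μ (μ * 2) ≤-refl refl))))))
  where r<l = m≤n⇒m≤1+n r<2μ

-- Words as periodic sequences

-- Continued by zeros without end, so that one function describes the blocks of both lengths.
comb : ℕ → ℕ → Bool
comb zero    zero          = true
comb zero    (suc i)       = false
comb (suc μ) zero          = true
comb (suc μ) (suc zero)    = false
comb (suc μ) (suc (suc i)) = comb μ i

comb-zero : ∀ μ → comb μ 0 ≡ true
comb-zero zero    = refl
comb-zero (suc μ) = refl

comb-alternates : ∀ μ i → i < suc (μ * 2) → comb μ (suc i) ≡ not (comb μ i)
comb-alternates zero    zero          _               = refl
comb-alternates zero    (suc i)       (s≤s ())
comb-alternates (suc μ) zero          _               = refl
comb-alternates (suc μ) (suc zero)    _               = comb-zero μ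
comb-alternates (suc μ) (suc (suc i)) (s≤s (s≤s i<l)) = comb-alternates μ i i<l

comb-tail : ∀ μ d → comb μ (suc (μ * 2) + d) ≡ false
comb-tail zero    d = refl
comb-tail (suc μ) d = comb-tail μ d

∑-comb : ∀ μ d f → ∑ (suc (μ * 2) + d) (λ i → ⟦ comb μ i ⟧ * f i) ≡ ∑ (suc μ) (λ i → f (i * 2))
∑-comb zero    d f = cong₂ _+_ (*-identityˡ (f 0)) (trans (∑-const d 0) (*-zeroʳ d))
∑-comb (suc μ) d f = cong₂ _+_ (*-identityˡ (f 0)) (∑-comb μ d (λ i → f (2 + i)))

-- The NOR recurrence along a word

Nor : ℕ → (ℕ → Bool) → ℕ → Set
Nor l f c = f (suc (c + l)) ≡ not (f c) ∧ not (f (suc c)) ∧ not (f (suc (suc (c + l))))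

nor-resp : ∀ {l} f f′ c c′ → f (suc (c + l)) ≡ f′ (suc (c′ + l)) → f c ≡ f′ c′ → f (suc c) ≡ f′ (suc c′) →
           f (suc (suc (c + l))) ≡ f′ (suc (suc (c′ + l))) → Nor l f c → Nor l f′ c′
nor-resp f f′ c c′ p q r s nor =
  trans (sym p) (trans nor (cong₂ (λ a b → not a ∧ b) q (cong₂ (λ a b → not a ∧ not b) r s)))

word : ℕ → List Bool → ℕ → Bool
word μ []       q = false
word μ (e ∷ es) q = if q <ᵇ blockLength (suc (μ * 2)) e then comb μ q else word μ es (q ∸ blockLength (suc (μ * 2)) e)

<⇒<ᵇ≡true : ∀ {m n} → m < n → (m <ᵇ n) ≡ true
<⇒<ᵇ≡true {zero}  (s≤s _)   = refl
<⇒<ᵇ≡true {suc m} (s≤s m<n) = <⇒<ᵇ≡true m<n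

≤⇒<ᵇ≡false : ∀ {m n} → n ≤ m → (m <ᵇ n) ≡ false
≤⇒<ᵇ≡false z≤n       = refl
≤⇒<ᵇ≡false (s≤s n≤m) = ≤⇒<ᵇ≡false n≤m

module Word (μ : ℕ) where

  open ≡-Reasoning

  l : ℕ
  l = suc (μ * 2)

  L : Bool → ℕ
  L = blockLength l

  word-head : ∀ e es i → i < L e → word μ (e ∷ es) i ≡ comb μ i
  word-head e es i i<L rewrite <⇒<ᵇ≡true i<L = refl

  word-tail : ∀ e es i → word μ (e ∷ es) (L e + i) ≡ word μ es i
  word-tail e es i rewrite ≤⇒<ᵇ≡false (m≤m+n (L e) i) = cong (word μ es) (m+n∸m≡n (L e) i)

  word-weight : ∀ g → Periodic l g → ∀ es c →
                ∑ (wordLength l es) (λ q → ⟦ word μ es q ⟧ * g (c + q)) ≡ weight l (combSum μ g) es c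
  word-weight g per []       c = refl
  word-weight g per (e ∷ es) c = begin
    ∑ (L e + wordLength l es) (λ q → ⟦ word μ (e ∷ es) q ⟧ * g (c + q))
      ≡⟨ ∑-split (L e) (wordLength l es) _ ⟩
    ∑ (L e) (λ q → ⟦ word μ (e ∷ es) q ⟧ * g (c + q))
      + ∑ (wordLength l es) (λ q → ⟦ word μ (e ∷ es) (L e + q) ⟧ * g (c + (L e + q)))
      ≡⟨ cong₂ _+_ head (∑-cong′ (wordLength l es) λ q → cong₂ (λ b x → ⟦ b ⟧ * x) (word-tail e es q) (wrap q)) ⟩
    combSum μ g c + ∑ (wordLength l es) (λ q → ⟦ word μ es q ⟧ * g (c + suc ⟦ e ⟧ + q))
      ≡⟨ cong (combSum μ g c +_) (word-weight g per es (c + suc ⟦ e ⟧)) ⟩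
    combSum μ g c + weight l (combSum μ g) es (c + suc ⟦ e ⟧) ∎
    where
    head : ∑ (L e) (λ q → ⟦ word μ (e ∷ es) q ⟧ * g (c + q)) ≡ combSum μ g c
    head = begin
      ∑ (L e) (λ q → ⟦ word μ (e ∷ es) q ⟧ * g (c + q))
        ≡⟨ ∑-cong (L e) (λ q q<L → cong (λ b → ⟦ b ⟧ * g (c + q)) (word-head e es q q<L)) ⟩
      ∑ (L e) (λ q → ⟦ comb μ q ⟧ * g (c + q))
        ≡⟨ cong (λ n → ∑ n (λ q → ⟦ comb μ q ⟧ * g (c + q))) (length ⟦ e ⟧ l) ⟩
      ∑ (l + (⟦ e ⟧ + suc l)) (λ q → ⟦ comb μ q ⟧ * g (c + q))
        ≡⟨ ∑-comb μ _ (λ q → g (c + q)) ⟩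
      combSum μ g c ∎
      where
      length : ∀ e l → e + (suc l + l) ≡ l + (e + suc l)
      length = solve-∀

    wrap : ∀ q → g (c + (L e + q)) ≡ g (c + suc ⟦ e ⟧ + q)
    wrap q = trans (cong g (shift c ⟦ e ⟧ l q)) (periodic-* per 2 (c + suc ⟦ e ⟧ + q))
      where
      shift : ∀ c e l q → c + ((e + (suc l + l)) + q) ≡ c + suc e + q + 2 * l
      shift = solve-∀

  -- The values required after the block number `suc l + l`, the length of the shorter block: both
  -- kinds of block agree that far, so it does not matter which one follows.
  module Block (e : Bool) (f : ℕ → Bool)
               (here : ∀ i → i < L e → f i ≡ comb μ i)
               (next : ∀ i → i < suc l + l → f (L e + i) ≡ comb μ i) where

    tail : ∀ d → ⟦ e ⟧ + (l + d) < L e → f (⟦ e ⟧ + (l + d)) ≡ false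
    tail d <L = trans (here _ <L) (trans (cong (comb μ) (swap ⟦ e ⟧ l d)) (comb-tail μ (⟦ e ⟧ + d)))
      where
      swap : ∀ e l d → e + (l + d) ≡ l + (e + d)
      swap = solve-∀

    -- Exactly one of the positions `c` and `c + 1` of the comb carries a one, which makes the NOR
    -- false, and position `c + l + 1` lies in the zeros of the block.
    nor-early : ∀ c → c < l → Nor l f c
    nor-early c c<l = begin
      f (suc (c + l))
        ≡⟨ here _ (≤-trans (s≤s (+-monoˡ-≤ l c<l)) (m≤n+m (suc l + l) ⟦ e ⟧)) ⟩
      comb μ (suc (c + l))
        ≡⟨ cong (comb μ) (swap c l) ⟩
      comb μ (l + suc c)
        ≡⟨ comb-tail μ (suc c) ⟩
      false
        ≡⟨ lemma (comb μ c) _ ⟨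
      not (comb μ c) ∧ not (not (comb μ c)) ∧ not (f (suc (suc (c + l))))
        ≡⟨ cong₂ (λ a b → not a ∧ not b ∧ not (f (suc (suc (c + l))))) fc fsc ⟨
      not (f c) ∧ not (f (suc c)) ∧ not (f (suc (suc (c + l)))) ∎
      where
      swap : ∀ c l → suc (c + l) ≡ l + suc c
      swap = solve-∀
      lemma : ∀ a b → not a ∧ not (not a) ∧ b ≡ false
      lemma true  b = refl
      lemma false b = refl
      l<L : suc l ≤ L e
      l<L = ≤-trans (m≤m+n (suc l) l) (m≤n+m (suc l + l) ⟦ e ⟧)
      fc : f c ≡ comb μ c
      fc = here c (≤-trans (m≤n⇒m≤1+n c<l) l<L)
      fsc : f (suc c) ≡ not (comb μ c)
      fsc = trans (here (suc c) (≤-trans (s≤s c<l) l<L)) (comb-alternates μ c c<l)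

    -- Here `c + l + 1` is position `d` of the next block. For `d < l` both `c` and `c + 1` lie in
    -- zeros, so the equation reduces to the alternation of the comb. For `d = l` position `c + 1`
    -- is the leading one of the next block and forces the zero after its comb.
    nor-late : ∀ d → d ≤ l → Nor l f (⟦ e ⟧ + (l + d))
    nor-late d d≤l = begin
      f (suc (c + l))
        ≡⟨ trans (cong f (index ⟦ e ⟧ l d)) (next d (s≤s (≤-trans d≤l (m≤m+n l l)))) ⟩
      comb μ d
        ≡⟨ choose (m≤n⇒m<n∨m≡n d≤l) ⟩
      not (f (suc c)) ∧ not (comb μ (suc d))
        ≡⟨ cong₂ (λ a b → not a ∧ not (f (suc c)) ∧ not b) (tail d c<L) fssc ⟨
      not (f c) ∧ not (f (suc c)) ∧ not (f (suc (suc (c + l)))) ∎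
      where
      c = ⟦ e ⟧ + (l + d)
      index : ∀ e l d → suc (e + (l + d) + l) ≡ (e + (suc l + l)) + d
      index = solve-∀
      c<L : c < L e
      c<L = subst (_≤ L e) (+-suc ⟦ e ⟧ (l + d)) (+-monoʳ-≤ ⟦ e ⟧ (s≤s (+-monoʳ-≤ l d≤l)))
      fssc : f (suc (suc (c + l))) ≡ comb μ (suc d)
      fssc = trans (cong f (trans (cong suc (index ⟦ e ⟧ l d)) (sym (+-suc (L e) d))))
                   (next (suc d) (s≤s (≤-trans (s≤s d≤l) (+-monoˡ-≤ l (s≤s (z≤n {μ * 2}))))))
      c+1≡ : suc c ≡ ⟦ e ⟧ + (l + suc d)
      c+1≡ = trans (sym (+-suc ⟦ e ⟧ (l + d))) (cong (⟦ e ⟧ +_) (sym (+-suc l d)))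
      choose : d < l ⊎ d ≡ l → comb μ d ≡ not (f (suc c)) ∧ not (comb μ (suc d))
      choose (inj₁ d<l) = begin
        comb μ d                                      ≡⟨ not-involutive (comb μ d) ⟨
        not (not (comb μ d))                          ≡⟨ cong not (comb-alternates μ d d<l) ⟨
        not (comb μ (suc d))                          ≡⟨ cong (λ b → not b ∧ not (comb μ (suc d))) fsc ⟨
        not (f (suc c)) ∧ not (comb μ (suc d))        ∎
        where
        fsc : f (suc c) ≡ false
        fsc = trans (cong f c+1≡) (tail (suc d) (subst (_≤ L e) (+-suc ⟦ e ⟧ (l + suc d))
                (+-monoʳ-≤ ⟦ e ⟧ (s≤s (+-monoʳ-≤ l d<l)))))
      choose (inj₂ refl) = begin
        comb μ l                                      ≡⟨ cong (comb μ) (+-identityʳ l) ⟨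
        comb μ (l + 0)                                ≡⟨ comb-tail μ 0 ⟩
        false                                         ≡⟨ cong (λ b → not b ∧ not (comb μ (suc l))) fsc ⟨
        not (f (suc c)) ∧ not (comb μ (suc l))        ∎
        where
        restart : ∀ e l → suc (e + (l + l)) ≡ e + (suc l + l) + 0
        restart = solve-∀
        fsc : f (suc c) ≡ true
        fsc = trans (cong f (restart ⟦ e ⟧ l)) (trans (next 0 z<s) (comb-zero μ))

  nor-block : ∀ e f → (∀ i → i < L e → f i ≡ comb μ i) → (∀ i → i < suc l + l → f (L e + i) ≡ comb μ i) →
              ∀ c → c < L e → Nor l f c
  nor-block e f here next c c<L with <-≤-connex c l
  ... | inj₁ c<l = Block.nor-early e f here next c c<l
  ... | inj₂ l≤c = subst (Nor l f) (m+[n∸m]≡n l≤c) (late e here next (c ∸ l) (subst (_< L e) (sym (m+[n∸m]≡n l≤c)) c<L))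
    where
    late : ∀ e → (∀ i → i < L e → f i ≡ comb μ i) → (∀ i → i < suc l + l → f (L e + i) ≡ comb μ i) →
           ∀ d → l + d < L e → Nor l f (l + d)
    late false here next d d<L = Block.nor-late false f here next d (+-cancelˡ-≤ l d l (s≤s⁻¹ d<L))
    late true  here next (suc d) d<L = subst (Nor l f) (sym (+-suc l d))
      (Block.nor-late true f here next d (+-cancelˡ-≤ l d l (s≤s⁻¹ (s≤s⁻¹ (subst (_< L true) (+-suc l d) d<L)))))
    -- The long block leaves one position between the early and the late range. Its output is the
    -- last zero of the block, forced by the leading one of the next block.
    late true  here next zero    _   = subst (Nor l f) (sym (+-identityʳ l)) (begin
      f (suc (l + l))
        ≡⟨ here _ ≤-refl ⟩
      comb μ (suc (l + l))
        ≡⟨ cong (comb μ) (+-suc l l) ⟨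
      comb μ (l + suc l)
        ≡⟨ comb-tail μ (suc l) ⟩
      false
        ≡⟨ lemma (f l) (f (suc l)) ⟨
      not (f l) ∧ not (f (suc l)) ∧ false
        ≡⟨ cong (λ b → not (f l) ∧ not (f (suc l)) ∧ not b) fL ⟨
      not (f l) ∧ not (f (suc l)) ∧ not (f (suc (suc (l + l)))) ∎)
      where
      lemma : ∀ a b → not a ∧ not b ∧ false ≡ false
      lemma a b = trans (cong (not a ∧_) (∧-zeroʳ (not b))) (∧-zeroʳ (not a))
      fL : f (suc (suc (l + l))) ≡ true
      fL = trans (cong f (sym (+-identityʳ (L true)))) (trans (next 0 z<s) (comb-zero μ))

  start≤block : ∀ e → suc l + l ≤ L e
  start≤block e = m≤n+m (suc l + l) ⟦ e ⟧

  -- The recurrence looks past the end of the word, hence a whole sequence `f` that also contains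
  -- the start of one further block. This form is inherited by `f` shifted by one block, which gives
  -- the induction.
  nor-word : ∀ es f → (∀ i → i < wordLength l es → f i ≡ word μ es i) →
             (∀ i → i < suc l + l → f (wordLength l es + i) ≡ comb μ i) →
             ∀ c → c < wordLength l es → Nor l f c
  nor-word (e ∷ es) f reads next c c<len with <-≤-connex c (L e)
  ... | inj₁ c<L = nor-block e f
          (λ i i<L → trans (reads i (≤-trans i<L (m≤m+n (L e) _))) (word-head e es i i<L))
          (start es reads next) c c<L
    where
    start : ∀ es → (∀ i → i < wordLength l (e ∷ es) → f i ≡ word μ (e ∷ es) i) →
            (∀ i → i < suc l + l → f (wordLength l (e ∷ es) + i) ≡ comb μ i) →
            ∀ i → i < suc l + l → f (L e + i) ≡ comb μ i
    start []        reads next i i<s = trans (cong (λ n → f (n + i)) (sym (+-identityʳ (L e)))) (next i i<s)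
    start (e′ ∷ es) reads next i i<s = trans
      (reads (L e + i) (+-monoʳ-< (L e) (≤-trans i<L′ (m≤m+n (L e′) _))))
      (trans (word-tail e (e′ ∷ es) i) (word-head e′ es i i<L′))
      where i<L′ = ≤-trans i<s (start≤block e′)
  ... | inj₂ L≤c = subst (Nor l f) (m+[n∸m]≡n L≤c)
          (nor-resp (λ i → f (L e + i)) f d (L e + d) (cong f (index d)) refl (cong f (+-suc (L e) d))
                    (cong f (trans (+-suc (L e) (suc (d + l))) (cong suc (index d))))
            (nor-word es (λ i → f (L e + i))
              (λ i i<len → trans (reads (L e + i) (+-monoʳ-< (L e) i<len)) (word-tail e es i))
              (λ i i<s → trans (cong f (sym (+-assoc (L e) _ i))) (next i i<s))
              d (+-cancelˡ-< (L e) d _ (subst (_< wordLength l (e ∷ es)) (sym (m+[n∸m]≡n L≤c)) c<len))))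
    where
    d = c ∸ L e
    index : ∀ d → L e + suc (d + l) ≡ suc (L e + d + l)
    index d = trans (+-suc (L e) (d + l)) (cong suc (sym (+-assoc (L e) d l)))

-- The word is given with a first block, so that `p` is positive and the sequence has a block start
-- to return to after `p` places.
module CyclicWord (μ : ℕ) (e : Bool) (es : List Bool) where

  open Word μ public
  open ≡-Reasoning

  p : ℕ
  p = wordLength l (e ∷ es)

  instance
    p-nonZero : NonZero p
    p-nonZero = >-nonZero (≤-trans (≤-trans (s≤s z≤n) (start≤block e)) (m≤m+n (L e) _))

  z : ℕ → Bool
  z q = word μ (e ∷ es) (q % p)

  z-periodic : Periodic p z
  z-periodic q = cong (word μ (e ∷ es)) ([m+n]%n≡m%n q p)

  z-nor : ∀ q → Nor l z q
  z-nor q = nor-resp z z (q % p) q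
    (move (λ t → suc (t + l)) (λ t → cong suc (swap (q % p) t l))) (move (λ t → t) (λ _ → refl))
    (move suc (λ _ → refl)) (move (λ t → suc (suc (t + l))) (λ t → cong (suc ∘ suc) (swap (q % p) t l)))
    (nor-word (e ∷ es) z (λ i i<p → cong (word μ (e ∷ es)) (m<n⇒m%n≡m i<p)) start (q % p) (m%n<n q p))
    where
    swap : ∀ a b c → a + b + c ≡ a + c + b
    swap = solve-∀
    start : ∀ i → i < suc l + l → z (p + i) ≡ comb μ i
    start i i<s = begin
      z (p + i)               ≡⟨ cong z (+-comm p i) ⟩
      z (i + p)               ≡⟨ z-periodic i ⟩
      z i                     ≡⟨ cong (word μ (e ∷ es)) (m<n⇒m%n≡m (≤-trans i<L (m≤m+n (L e) _))) ⟩
      word μ (e ∷ es) i       ≡⟨ word-head e es i i<L ⟩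
      comb μ i                ∎
      where i<L = ≤-trans i<s (start≤block e)
    -- `F` runs through the four index shifts of `Nor`, each of which commutes with adding a
    -- multiple of `p`.
    move : ∀ F → (∀ t → F (q % p + t) ≡ F (q % p) + t) → z (F (q % p)) ≡ z (F q)
    move F shift = begin
      z (F (q % p))                        ≡⟨ periodic-* z-periodic (q / p) (F (q % p)) ⟨
      z (F (q % p) + q / p * p)            ≡⟨ cong z (shift (q / p * p)) ⟨
      z (F (q % p + q / p * p))            ≡⟨ cong (z ∘ F) (m≡m%n+[m/n]*n q p) ⟨
      z (F q)                              ∎

  -- As `T * l` is a full period, the positions `i * l + r` are exactly those of the class `r` in
  -- one copy of the word.
  residueCount : ∀ T → T * l ≡ p → ∀ r → r < l →
                 ∑ T (λ i → ⟦ z (i * l + r) ⟧) ≡ weight l (combSum μ (residue (μ * 2) r)) (e ∷ es) 0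
  residueCount T T*l≡p r r<l = begin
    ∑ T (λ i → ⟦ z (i * l + r) ⟧)
      ≡⟨ ∑-cong′ T (λ i → ∑-select l (λ s → ⟦ z (i * l + s) ⟧) r r<l) ⟨
    ∑ T (λ i → ∑ l (λ s → ⟦ z (i * l + s) ⟧ * ⟦ s ≡ᵇ r ⟧))
      ≡⟨ ∑-cong′ T (λ i → ∑-cong l (λ s s<l → cong (⟦ z (i * l + s) ⟧ *_) (class i s s<l))) ⟨
    ∑ T (λ i → ∑ l (λ s → ⟦ z (i * l + s) ⟧ * g (i * l + s)))
      ≡⟨ ∑-blocks T l (λ q → ⟦ z q ⟧ * g q) ⟨
    ∑ (T * l) (λ q → ⟦ z q ⟧ * g q)
      ≡⟨ cong (λ n → ∑ n (λ q → ⟦ z q ⟧ * g q)) T*l≡p ⟩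
    ∑ p (λ q → ⟦ z q ⟧ * g q)
      ≡⟨ ∑-cong p (λ q q<p → cong (λ t → ⟦ word μ (e ∷ es) t ⟧ * g q) (m<n⇒m%n≡m q<p)) ⟩
    ∑ p (λ q → ⟦ word μ (e ∷ es) q ⟧ * g q)
      ≡⟨ word-weight g g-periodic (e ∷ es) 0 ⟩
    weight l (combSum μ g) (e ∷ es) 0 ∎
    where
    g = residue (μ * 2) r
    g-periodic = residue-periodic (μ * 2) r
    class : ∀ i s → s < l → g (i * l + s) ≡ ⟦ s ≡ᵇ r ⟧
    class i s s<l = trans (cong g (+-comm (i * l) s))
                          (trans (periodic-* g-periodic i s) (residue-< (μ * 2) r s s<l))

-- Scrolls as recurrent sequences

-- A one is always cleared, and the NOR is false there as well, since the old value is among its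
-- arguments. This removes the case distinction from the toggle.
toggle-nor : ∀ {n} (k : Fin n) x → toggle k x ≡
  x [ k ]≔ (not (lookup x k) ∧ not (get x (toℕ k + (n ∸ 1))) ∧ not (get x (toℕ k + 1)))
toggle-nor k x with lookup x k
... | true  = refl
... | false = refl

get-tabulate : ∀ n (F : ℕ → Bool) j → get {suc n} (tabulate (F ∘ toℕ)) j ≡ F (j % suc n)
get-tabulate n F j = trans (lookup∘tabulate (F ∘ toℕ) (fromℕ< (m%n<n j (suc n))))
                           (cong F (toℕ-fromℕ< (m%n<n j (suc n))))

lookup-ext : ∀ {n} {x y : Config n} → (∀ i → lookup x i ≡ lookup y i) → x ≡ y
lookup-ext {x = x} {y} eq = trans (sym (tabulate∘lookup x)) (trans (tabulate-cong eq) (tabulate∘lookup y))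

-- Reading the rows of a scroll one after the other gives a single sequence y,
-- in which the left and right neighbours across the seam are also consecutive.
module Scroll (n₀ : ℕ) (y : ℕ → Bool)
  (recurrence : ∀ m → y (suc (suc n₀) + m) ≡ not (y m) ∧ not (y (suc n₀ + m)) ∧ not (y (suc m))) where

  open ≡-Reasoning

  n : ℕ
  n = suc (suc n₀)

  row : ℕ → Config n
  row m = tabulate (λ j → y (toℕ j + m))

  get-row : ∀ m j → get (row m) j ≡ y (j % n + m)
  get-row m j = get-tabulate (suc n₀) (λ j → y (j + m)) j

  row-get : ∀ {j} → j < n → get (row 0) j ≡ y j
  row-get {j} j<n = trans (get-row 0 j) (cong y (trans (+-identityʳ (j % n)) (m<n⇒m%n≡m j<n)))

  -- The configuration in mid-sweep: the vertices below `t` are already toggled and carry the next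
  -- row.
  partial : ℕ → ℕ → ℕ → Bool
  partial m t j = if j <ᵇ t then y (n + (j + m)) else y (j + m)

  partial-new : ∀ m t j → j < t → partial m t j ≡ y (n + (j + m))
  partial-new m t j j<t rewrite <⇒<ᵇ≡true j<t = refl

  partial-old : ∀ m t j → t ≤ j → partial m t j ≡ y (j + m)
  partial-old m t j t≤j rewrite ≤⇒<ᵇ≡false t≤j = refl

  state : ℕ → ℕ → Config n
  state m t = tabulate (partial m t ∘ toℕ)

  -- The left neighbour is already toggled, except that vertex 0 looks across the seam at an old
  -- value; the index in `y` is the same either way. Dually, in `right` only the last vertex sees a
  -- toggled neighbour.
  left : ∀ m t → t < n → get (state m t) (t + suc n₀) ≡ y (suc n₀ + (t + m))
  left m zero    _   = begin
    get (state m 0) (suc n₀)      ≡⟨ get-tabulate (suc n₀) (partial m 0) (suc n₀) ⟩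
    partial m 0 (suc n₀ % n)      ≡⟨ cong (partial m 0) (m<n⇒m%n≡m {n = n} ≤-refl) ⟩
    y (suc n₀ + m)                ∎
  left m (suc t) t<n = begin
    get (state m (suc t)) (suc t + suc n₀)   ≡⟨ get-tabulate (suc n₀) (partial m (suc t)) (suc t + suc n₀) ⟩
    partial m (suc t) ((suc t + suc n₀) % n) ≡⟨ cong (λ i → partial m (suc t) (i % n)) (+-suc t (suc n₀)) ⟨
    partial m (suc t) ((t + n) % n)          ≡⟨ cong (partial m (suc t)) (trans ([m+n]%n≡m%n t n) (m<n⇒m%n≡m {n = n} (<-trans ≤-refl t<n))) ⟩
    partial m (suc t) t                      ≡⟨ partial-new m (suc t) t ≤-refl ⟩
    y (suc (suc n₀) + (t + m))               ≡⟨ cong y (+-suc (suc n₀) (t + m)) ⟨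
    y (suc n₀ + (suc t + m))                 ∎

  right : ∀ m t → t < n → get (state m t) (t + 1) ≡ y (suc (t + m))
  right m t t<n with m≤n⇒m<n∨m≡n t<n
  ... | inj₁ st<n = begin
    get (state m t) (t + 1)     ≡⟨ get-tabulate (suc n₀) (partial m t) (t + 1) ⟩
    partial m t ((t + 1) % n)   ≡⟨ cong (λ i → partial m t (i % n)) (+-comm t 1) ⟩
    partial m t (suc t % n)     ≡⟨ cong (partial m t) (m<n⇒m%n≡m {n = n} st<n) ⟩
    partial m t (suc t)         ≡⟨ partial-old m t (suc t) (n≤1+n t) ⟩
    y (suc (t + m))             ∎
  ... | inj₂ refl = begin
    get (state m t) (t + 1)     ≡⟨ get-tabulate (suc n₀) (partial m t) (t + 1) ⟩
    partial m t ((t + 1) % n)   ≡⟨ cong (λ i → partial m t (i % n)) (+-comm t 1) ⟩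
    partial m t (suc t % n)     ≡⟨ cong (partial m t) (n%n≡0 n) ⟩
    partial m t 0               ≡⟨ partial-new m t 0 z<s ⟩
    y (suc (t + m))             ∎

  toggle-state : ∀ m (k : Fin n) → toggle k (state m (toℕ k)) ≡ state m (suc (toℕ k))
  toggle-state m k = trans (toggle-nor k (state m t)) (lookup-ext agree)
    where
    t = toℕ k
    t<n = toℕ<n k

    new : not (lookup (state m t) k) ∧ not (get (state m t) (t + suc n₀)) ∧ not (get (state m t) (t + 1))
          ≡ partial m (suc t) t
    new = begin
      not (lookup (state m t) k) ∧ not (get (state m t) (t + suc n₀)) ∧ not (get (state m t) (t + 1))
        ≡⟨ cong₂ (λ a b → not a ∧ b) (trans (lookup∘tabulate (partial m t ∘ toℕ) k) (partial-old m t t ≤-refl))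
             (cong₂ (λ a b → not a ∧ not b) (left m t t<n) (right m t t<n)) ⟩
      not (y (t + m)) ∧ not (y (suc n₀ + (t + m))) ∧ not (y (suc (t + m)))
        ≡⟨ recurrence (t + m) ⟨
      y (n + (t + m))
        ≡⟨ partial-new m (suc t) t ≤-refl ⟨
      partial m (suc t) t ∎

    unchanged : ∀ j → j ≢ t → partial m t j ≡ partial m (suc t) j
    unchanged j j≢t with <-≤-connex j t
    ... | inj₁ j<t = trans (partial-new m t j j<t) (sym (partial-new m (suc t) j (m≤n⇒m≤1+n j<t)))
    ... | inj₂ t≤j = trans (partial-old m t j t≤j) (sym (partial-old m (suc t) j (≤∧≢⇒< t≤j (λ t≡j → j≢t (sym t≡j)))))

    agree : ∀ j → lookup (state m t [ k ]≔ _) j ≡ lookup (state m (suc t)) j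
    agree j with k ≟ᶠ j
    ... | yes refl = trans (lookup∘update k (state m t) _) (trans new (sym (lookup∘tabulate (partial m (suc t) ∘ toℕ) k)))
    ... | no  k≢j  = trans (lookup∘update′ (λ j≡k → k≢j (sym j≡k)) (state m t) _)
      (trans (lookup∘tabulate (partial m t ∘ toℕ) j)
      (trans (unchanged (toℕ j) (λ eq → k≢j (sym (toℕ-injective eq))))
             (sym (lookup∘tabulate (partial m (suc t) ∘ toℕ) j))))

  -- `h` stands for a tail of `allFin n`, because the fold over the vertices consumes that list from
  -- the front.
  sweep : ∀ m s t (h : Fin s → Fin n) → (∀ i → toℕ (h i) ≡ t + toℕ i) →
          foldl (λ x k → toggle k x) (state m t) (tabulateˡ h) ≡ state m (t + s)
  sweep m zero    t h h≡ = cong (state m) (sym (+-identityʳ t))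
  sweep m (suc s) t h h≡ = begin
    foldl f (toggle (h fzero) (state m t)) (tabulateˡ (h ∘ fsuc))
      ≡⟨ cong (λ x → foldl f x (tabulateˡ (h ∘ fsuc))) step ⟩
    foldl f (state m (suc t)) (tabulateˡ (h ∘ fsuc))
      ≡⟨ sweep m s (suc t) (h ∘ fsuc) (λ i → trans (h≡ (fsuc i)) (+-suc t (toℕ i))) ⟩
    state m (suc t + s)
      ≡⟨ cong (state m) (+-suc t s) ⟨
    state m (t + suc s) ∎
    where
    f : Config n → Fin n → Config n
    f x k = toggle k x
    h0≡t : toℕ (h fzero) ≡ t
    h0≡t = trans (h≡ fzero) (+-identityʳ t)
    step : toggle (h fzero) (state m t) ≡ state m (suc t)
    step = subst (λ t → toggle (h fzero) (state m t) ≡ state m (suc t)) h0≡t (toggle-state m (h fzero))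

  tau-row : ∀ m → tau (row m) ≡ row (n + m)
  tau-row m = trans (sweep m n 0 (λ i → i) (λ _ → refl)) (tabulate-cong λ j →
    trans (partial-new m n (toℕ j) (toℕ<n j)) (cong y (swap n (toℕ j) m)))
    where
    swap : ∀ a b c → a + (b + c) ≡ b + (a + c)
    swap = solve-∀

  tauIter-row : ∀ i → tauIter i (row 0) ≡ row (i * n)
  tauIter-row zero    = refl
  tauIter-row (suc i) = trans (cong tau (tauIter-row i)) (tau-row (i * n))

  module _ (T : ℕ) (periodic : Periodic (suc T * n) y) where

    tauIter-period : tauIter (suc T) (row 0) ≡ row 0
    tauIter-period = trans (tauIter-row (suc T)) (tabulate-cong λ j →
      trans (periodic (toℕ j)) (cong y (sym (+-identityʳ (toℕ j)))))

    private
      nor-∧₂ : ∀ a b c → a ≡ true → not b ∧ not a ∧ c ≡ false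
      nor-∧₂ a b c refl = ∧-zeroʳ (not b)

      nor-∧₃ : ∀ a b c → c ≡ true → not a ∧ not b ∧ not c ≡ false
      nor-∧₃ a b c refl = trans (cong (not a ∧_) (∧-zeroʳ (not b))) (∧-zeroʳ (not a))

      excludes : ∀ {a b} → (a ≡ true → b ≡ false) → a ∧ b ≡ false
      excludes {false} _ = refl
      excludes {true}  h = h refl

      -- Every value is an output of the recurrence one period later.
      later : ∀ m → ∃ λ m′ → n + m′ ≡ suc (m + suc T * n)
      later m = suc (m + T * n) , shift n m (T * n)
        where
        shift : ∀ n m t → n + suc (m + t) ≡ suc (m + (n + t))
        shift = solve-∀

    -- One period later `y (suc m)` is an output of the recurrence with `y m` as its input at offset
    -- `n - 1`, so a one there forces a zero. `seam-excluded` uses the input at offset 1 in the same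
    -- way.
    adjacent-excluded : ∀ m → y m ∧ y (suc m) ≡ false
    adjacent-excluded m = excludes λ ym → let m′ , eq = later m in begin
      y (suc m)                     ≡⟨ periodic (suc m) ⟨
      y (suc (m + suc T * n))           ≡⟨ cong y eq ⟨
      y (n + m′)                    ≡⟨ recurrence m′ ⟩
      not (y m′) ∧ not (y (suc n₀ + m′)) ∧ not (y (suc m′))
                                    ≡⟨ nor-∧₂ _ (y m′) _ (trans (cong y (suc-injective eq)) (trans (periodic m) ym)) ⟩
      false                         ∎

    seam-excluded : ∀ m → y (suc n₀ + m) ∧ y m ≡ false
    seam-excluded m = trans (∧-comm (y (suc n₀ + m)) (y m)) (excludes λ ym → let m′ , eq = later m in begin
      y (suc n₀ + m)                ≡⟨ periodic (suc n₀ + m) ⟨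
      y (suc n₀ + m + suc T * n)        ≡⟨ cong y (trans (+-assoc (suc n₀) m (suc T * n)) (cong (suc n₀ +_) (sym (suc-injective eq)))) ⟩
      y (suc n₀ + suc (n₀ + m′))    ≡⟨ cong y (+-suc (suc n₀) (n₀ + m′)) ⟩
      y (n + (n₀ + m′))             ≡⟨ recurrence (n₀ + m′) ⟩
      not (y (n₀ + m′)) ∧ not (y (suc n₀ + (n₀ + m′))) ∧ not (y (suc (n₀ + m′)))
                                    ≡⟨ nor-∧₃ (y (n₀ + m′)) _ _ (trans (cong y (suc-injective eq)) (trans (periodic m) ym)) ⟩
      false                         ∎)

    row-independent : Independent (row 0)
    row-independent i with m≤n⇒m<n∨m≡n (toℕ<n i)
    ... | inj₁ si<n = trans (cong₂ _∧_ (row-get (<-trans ≤-refl si<n))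
                                       (trans (cong (get (row 0)) (+-comm (toℕ i) 1)) (row-get si<n)))
                            (adjacent-excluded (toℕ i))
    ... | inj₂ si≡n = trans (cong₂ _∧_ last first) (seam-excluded 0)
      where
      last : get (row 0) (toℕ i) ≡ y (suc n₀ + 0)
      last = trans (row-get (toℕ<n i)) (cong y (trans (suc-injective si≡n) (sym (+-identityʳ (suc n₀)))))
      first : get (row 0) (toℕ i + 1) ≡ y 0
      first = begin
        get (row 0) (toℕ i + 1)   ≡⟨ cong (get (row 0)) (trans (+-comm (toℕ i) 1) si≡n) ⟩
        get (row 0) n             ≡⟨ get-row 0 n ⟩
        y (n % n + 0)             ≡⟨ cong (λ j → y (j + 0)) (n%n≡0 n) ⟩
        y 0                       ∎

-- Exact periods from known multiples

least : ∀ {P : ℕ → Set} → Decidable P → ∀ n → 0 < n → P n →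
        ∃ λ m → 0 < m × P m × (∀ i → 0 < i → P i → m ≤ i)
least {P} P? = <-rec (λ n → 0 < n → P n → ∃ λ m → 0 < m × P m × (∀ i → 0 < i → P i → m ≤ i)) λ n smaller 0<n Pn →
  search n smaller 0<n Pn (anyUpTo? (λ i → (0 <? i) ×-dec P? i) n)
  where
  search : ∀ n → (∀ {m} → m < n → 0 < m → P m → ∃ λ m → 0 < m × P m × (∀ i → 0 < i → P i → m ≤ i)) →
           0 < n → P n → Dec (∃ λ i → i < n × 0 < i × P i) → ∃ λ m → 0 < m × P m × (∀ i → 0 < i → P i → m ≤ i)
  search n smaller _   _  (yes (i , i<n , 0<i , Pi)) = smaller i<n 0<i Pi
  search n _       0<n Pn (no none) = n , 0<n , Pn , λ i 0<i Pi → ≮⇒≥ λ i<n → none (i , i<n , 0<i , Pi)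

tauIter-+ : ∀ {n} a b (x : Config n) → tauIter (a + b) x ≡ tauIter a (tauIter b x)
tauIter-+ zero    b x = refl
tauIter-+ (suc a) b x = cong tau (tauIter-+ a b x)

tauIter-* : ∀ {n} c T (x : Config n) → tauIter T x ≡ x → tauIter (c * T) x ≡ x
tauIter-* zero    T x per = refl
tauIter-* (suc c) T x per = trans (tauIter-+ T (c * T) x) (trans (cong (tauIter T) (tauIter-* c T x per)) per)

scrollPeriod-divides : ∀ {n} (x : Config n) T → IsScrollPeriod x T → ∀ T₀ → tauIter T₀ x ≡ x → ∃ λ c → T₀ ≡ c * T
scrollPeriod-divides x (suc T) (_ , per , minimal) T₀ per₀ =
  T₀ / suc T , trans division (cong (_+ T₀ / suc T * suc T) remainder≡0)
  where
  division = m≡m%n+[m/n]*n T₀ (suc T)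
  remainder-period : tauIter (T₀ % suc T) x ≡ x
  remainder-period = trans (cong (tauIter (T₀ % suc T)) (sym (tauIter-* (T₀ / suc T) (suc T) x per)))
    (trans (sym (tauIter-+ (T₀ % suc T) _ x)) (trans (cong (λ t → tauIter t x) (sym division)) per₀))
  remainder≡0 : T₀ % suc T ≡ 0
  remainder≡0 with T₀ % suc T in eq | remainder-period
  ... | zero  | _     = refl
  ... | suc r | r-per = contradiction (minimal (suc r) z<s r-per) (<⇒≱ (subst (_< suc T) eq (m%n<n T₀ (suc T))))

sumVec≡∑ : ∀ {n} (x : Config n) T j → sumVec x T j ≡ ∑ T (λ i → ⟦ get (tauIter i x) j ⟧)
sumVec≡∑ x T j = cong sum (map-upTo _ T)

sumVec-* : ∀ {n} (x : Config n) T → tauIter T x ≡ x → ∀ c j → sumVec x (c * T) j ≡ c * sumVec x T j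
sumVec-* x T per c j = begin
  sumVec x (c * T) j                              ≡⟨ sumVec≡∑ x (c * T) j ⟩
  ∑ (c * T) (λ i → ⟦ get (tauIter i x) j ⟧)       ≡⟨ ∑-periods c T _ (λ i → cong (λ x → ⟦ get x j ⟧) (trans (tauIter-+ i T x) (cong (tauIter i) per))) ⟩
  c * ∑ T (λ i → ⟦ get (tauIter i x) j ⟧)         ≡⟨ cong (c *_) (sumVec≡∑ x T j) ⟨
  c * sumVec x T j                                ∎
  where open ≡-Reasoning

-- Summing over a multiple of the scroll period scales the sum vector by a positive factor, which
-- leaves its cyclic period unchanged. Hence the exact scroll period never has to be computed.
cyclicPeriod-from-multiple : ∀ {n} (x : Config n) T₀ → 0 < T₀ → tauIter T₀ x ≡ x → ∀ l →
  IsCyclicPeriod n (sumVec x T₀) l → Σ ℕ λ T → IsScrollPeriod x T × IsCyclicPeriod n (sumVec x T) l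
cyclicPeriod-from-multiple x T₀ 0<T₀ per₀ l (0<l , l-period , l-minimal)
  with least (λ T → ≡-dec _≟ᵇ_ (tauIter T x) x) T₀ 0<T₀ per₀
... | T , isPeriod@(0<T , per , _) with scrollPeriod-divides x T isPeriod T₀ per₀
... | suc c , refl = T , isPeriod , 0<l
    , (λ j → *-cancelˡ-≡ _ _ (suc c) (trans (sym (scale _)) (trans (l-period j) (scale _))))
    , λ m 0<m m-period → l-minimal m 0<m λ j →
        trans (scale _) (trans (cong (suc c *_) (m-period j)) (sym (scale _)))
  where
  scale : ∀ j → sumVec x (suc c * T) j ≡ suc c * sumVec x T j
  scale = sumVec-* x T per (suc c)

-- Scrolls from words

HasScroll : ℕ → ℕ → Set
HasScroll n l = Σ (Config n) λ x → Independent x × Σ ℕ λ T → IsScrollPeriod x T × IsCyclicPeriod n (sumVec x T) l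

-- The recurrence of a scroll on n vertices links offsets n, n - 1 and 1. Since
-- (l + 1) * n = l modulo p, multiplying by l + 1 turns them into l, -1 and l + 1,
-- which are the offsets linked by Nor l.
module WordScroll (μ : ℕ) (e : Bool) (es : List Bool) (n₀ k₀ : ℕ)
  (n≡ : suc (suc n₀) ≡ suc (suc k₀) * suc (μ * 2))
  (length≡ : suc (μ * 2) + wordLength (suc (μ * 2)) (e ∷ es) ≡ suc (suc (μ * 2)) * (suc (suc k₀) * suc (μ * 2)))
  (separates : SeparatesTop μ (e ∷ es)) where

  open CyclicWord μ e es
  open ≡-Reasoning

  y : ℕ → Bool
  y m = z (m * suc l)

  n k T₁ T₀ : ℕ
  n = suc (suc n₀)
  k = suc (suc k₀)
  -- Chosen so that `T₀` is `(l + 1) * k - 1`, which is `p` divided by `l`. It is some multiple of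
  -- the scroll period, not necessarily the least one.
  T₁ = k₀ + l * k
  T₀ = suc T₁

  n*[1+l]≡l+p : n * suc l ≡ l + p
  n*[1+l]≡l+p = trans (cong (_* suc l) n≡) (trans (*-comm (k * l) (suc l)) (sym length≡))

  T₀*l≡p : T₀ * l ≡ p
  T₀*l≡p = +-cancelˡ-≡ l _ _ (trans (*-assoc (suc l) k l) (sym length≡))

  previous : ∀ m → suc ((suc n₀ + m) * suc l) ≡ m * suc l + p
  previous m = +-cancelˡ-≡ l _ _ (begin
    l + suc ((suc n₀ + m) * suc l)    ≡⟨ +-suc l _ ⟩
    (n + m) * suc l                   ≡⟨ *-distribʳ-+ (suc l) n m ⟩
    n * suc l + m * suc l             ≡⟨ cong (_+ m * suc l) n*[1+l]≡l+p ⟩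
    l + p + m * suc l                 ≡⟨ rotate l p (m * suc l) ⟩
    l + (m * suc l + p)               ∎)
    where
    rotate : ∀ a b c → a + b + c ≡ a + (c + b)
    rotate = solve-∀

  y-recurrence : ∀ m → y (n + m) ≡ not (y m) ∧ not (y (suc n₀ + m)) ∧ not (y (suc m))
  y-recurrence m = begin
    z (suc l + q′)
      ≡⟨ cong (z ∘ suc) (+-comm l q′) ⟩
    z (suc (q′ + l))
      ≡⟨ z-nor q′ ⟩
    not (z q′) ∧ not (z (suc q′)) ∧ not (z (suc (suc (q′ + l))))
      ≡⟨ cong₂ (λ a b → not (z q′) ∧ not a ∧ not b) here next ⟩
    not (z q′) ∧ not (y m) ∧ not (y (suc m))
      ≡⟨ ∧-swap (not (z q′)) (not (y m)) _ ⟩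
    not (y m) ∧ not (z q′) ∧ not (y (suc m)) ∎
    where
    q′ = (suc n₀ + m) * suc l
    here : z (suc q′) ≡ y m
    here = trans (cong z (previous m)) (z-periodic (m * suc l))
    next : z (suc (suc (q′ + l))) ≡ y (suc m)
    next = begin
      z (suc (suc q′ + l))          ≡⟨ cong (λ t → z (suc (t + l))) (previous m) ⟩
      z (suc (m * suc l + p + l))   ≡⟨ cong z (rotate (m * suc l) p l) ⟩
      z (suc m * suc l + p)         ≡⟨ z-periodic (suc m * suc l) ⟩
      y (suc m)                     ∎
      where
      rotate : ∀ a b c → suc (a + b + c) ≡ (suc c + a) + b
      rotate = solve-∀
    ∧-swap : ∀ a b c → a ∧ b ∧ c ≡ b ∧ a ∧ c
    ∧-swap true  b     c = refl
    ∧-swap false true  c = refl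
    ∧-swap false false c = refl

  open Scroll n₀ y y-recurrence hiding (n)

  -- One row down advances `z` by `n * suc l`, that is by `l` up to the period, and one column to
  -- the right by `l + 1`. So each column stays in one residue class modulo `l`, and the next column
  -- is in the next class.
  y-row : ∀ j i → y (j + i * n) ≡ z (i * l + j * suc l)
  y-row j i = begin
    z ((j + i * n) * suc l)             ≡⟨ cong z (expand j i n l) ⟩
    z (i * (n * suc l) + j * suc l)     ≡⟨ cong (λ t → z (i * t + j * suc l)) n*[1+l]≡l+p ⟩
    z (i * (l + p) + j * suc l)         ≡⟨ cong z (collect i l p (j * suc l)) ⟩
    z (i * l + j * suc l + i * p)       ≡⟨ periodic-* z-periodic i (i * l + j * suc l) ⟩
    z (i * l + j * suc l)               ∎
    where
    expand : ∀ j i n l → (j + i * n) * suc l ≡ i * (n * suc l) + j * suc l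
    expand = solve-∀
    collect : ∀ i l p a → i * (l + p) + a ≡ i * l + a + i * p
    collect = solve-∀

  y-periodic : Periodic (T₀ * n) y
  y-periodic j = begin
    y (j + T₀ * n)              ≡⟨ y-row j T₀ ⟩
    z (T₀ * l + j * suc l)      ≡⟨ cong z (trans (+-comm _ (j * suc l)) (cong (j * suc l +_) T₀*l≡p)) ⟩
    z (j * suc l + p)           ≡⟨ z-periodic (j * suc l) ⟩
    y j                         ∎

  count : ℕ → ℕ
  count r = ∑ T₀ (λ i → ⟦ z (i * l + r) ⟧)

  -- Adding `l` to `r` only rotates the summation index, which is cyclic because `T₀` steps of `l`
  -- make up the period `p`.
  count-periodic : Periodic l count
  count-periodic r = trans (∑-cong′ T₀ λ i → cong (⟦_⟧ ∘ z) (carry i l r)) (∑-shift T₀ _ wrap 1)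
    where
    carry : ∀ i l r → i * l + (r + l) ≡ suc i * l + r
    carry = solve-∀
    distribute : ∀ i t l r → (i + t) * l + r ≡ i * l + r + t * l
    distribute = solve-∀
    wrap : Periodic T₀ (λ i → ⟦ z (i * l + r) ⟧)
    wrap i = cong ⟦_⟧ (begin
      z ((i + T₀) * l + r)      ≡⟨ cong z (distribute i T₀ l r) ⟩
      z (i * l + r + T₀ * l)    ≡⟨ cong (λ t → z (i * l + r + t)) T₀*l≡p ⟩
      z (i * l + r + p)         ≡⟨ z-periodic (i * l + r) ⟩
      z (i * l + r)             ∎)

  -- Modulo `l` the factor `suc l` is 1, and reducing `j` modulo `n` keeps its class because `l`
  -- divides `n`.
  sumVec≡count : ∀ j → sumVec (row 0) T₀ j ≡ count j
  sumVec≡count j = begin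
    sumVec (row 0) T₀ j                                   ≡⟨ sumVec≡∑ (row 0) T₀ j ⟩
    ∑ T₀ (λ i → ⟦ get (tauIter i (row 0)) j ⟧)            ≡⟨ ∑-cong′ T₀ (λ i → cong ⟦_⟧ (entry i)) ⟩
    count (j % n * suc l)                                 ≡⟨ cong count (*-suc (j % n) l) ⟩
    count (j % n + j % n * l)                             ≡⟨ periodic-* count-periodic (j % n) (j % n) ⟩
    count (j % n)                                         ≡⟨ periodic-* count-periodic (j / n * k) (j % n) ⟨
    count (j % n + j / n * k * l)                         ≡⟨ cong (λ t → count (j % n + t)) (*-assoc (j / n) k l) ⟩
    count (j % n + j / n * (k * l))                       ≡⟨ cong (λ t → count (j % n + j / n * t)) n≡ ⟨
    count (j % n + j / n * n)                             ≡⟨ cong count (m≡m%n+[m/n]*n j n) ⟨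
    count j                                               ∎
    where
    entry : ∀ i → get (tauIter i (row 0)) j ≡ z (i * l + j % n * suc l)
    entry i = trans (cong (λ x → get x j) (tauIter-row i)) (trans (get-row (i * n) j) (y-row (j % n) i))

  top<n : μ * 2 < n
  top<n = subst (l ≤_) (sym n≡) (m≤m+n l (suc k₀ * l))

  sumVec-cyclicPeriod : IsCyclicPeriod n (sumVec (row 0) T₀) l
  sumVec-cyclicPeriod = z<s
    , (λ j → trans (sumVec≡count (toℕ j + l)) (trans (count-periodic (toℕ j)) (sym (sumVec≡count (toℕ j)))))
    -- A shorter period `suc m` is tested at column `μ * 2`: it leads to `μ * 2 + suc m`, which
    -- equals `m + l` and so has class `m`, different from the top class.
    , λ { (suc m) _ m-period → ≮⇒≥ λ m<l → separated m (s≤s⁻¹ m<l) (period-top m m-period) }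
    where
    period-top : ∀ m → ((j : Fin n) → sumVec (row 0) T₀ (toℕ j + suc m) ≡ sumVec (row 0) T₀ (toℕ j)) →
                 count m ≡ count (μ * 2)
    period-top m m-period = begin
      count m                                 ≡⟨ count-periodic m ⟨
      count (m + l)                           ≡⟨ cong count (trans (+-comm m l) (sym (+-suc (μ * 2) m))) ⟩
      count (μ * 2 + suc m)                   ≡⟨ sumVec≡count (μ * 2 + suc m) ⟨
      sumVec (row 0) T₀ (μ * 2 + suc m)       ≡⟨ subst (λ t → sumVec (row 0) T₀ (t + suc m) ≡ sumVec (row 0) T₀ t)
                                                       (toℕ-fromℕ< top<n) (m-period (fromℕ< top<n)) ⟩
      sumVec (row 0) T₀ (μ * 2)               ≡⟨ sumVec≡count (μ * 2) ⟩
      count (μ * 2)                           ∎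
    separated : ∀ m → m < μ * 2 → count m ≢ count (μ * 2)
    separated m m<2μ eq = separates m m<2μ
      (trans (sym (residueCount T₀ T₀*l≡p m (m≤n⇒m≤1+n m<2μ))) (trans eq (residueCount T₀ T₀*l≡p (μ * 2) ≤-refl)))

  hasScroll : HasScroll n l
  hasScroll = row 0 , row-independent T₁ y-periodic
    , cyclicPeriod-from-multiple (row 0) T₀ z<s (tauIter-period T₁ y-periodic) l sumVec-cyclicPeriod

word⇒hasScroll : ∀ μ k₀ es → let l = suc (μ * 2) ; k = suc (suc k₀) in
                 l + wordLength l es ≡ suc l * (k * l) → SeparatesTop μ es → HasScroll (k * l) l
word⇒hasScroll μ k₀ []       length≡ _ = contradiction length≡ (<⇒≢ (begin-strict
  l + 0                           ≡⟨ +-identityʳ l ⟩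
  l                               <⟨ m<m+n l z<s ⟩
  l + suc k₀ * l                  ≤⟨ m≤m+n (k * l) (l * (k * l)) ⟩
  suc l * (k * l)                 ∎))
  where
  open ≤-Reasoning
  l = suc (μ * 2)
  k = suc (suc k₀)
word⇒hasScroll μ k₀ (e ∷ es) length≡ separates =
  -- The witness is `k * l - 2`, since `Scroll` takes the number of vertices in the form
  -- `suc (suc n₀)`.
  subst (λ n → HasScroll n l) (sym n≡) (WordScroll.hasScroll μ e es (μ * 2 + (μ * 2 + k₀ * l)) k₀ (sym n≡) length≡ separates)
  where
  l = suc (μ * 2)
  n≡ : suc (suc k₀) * l ≡ suc (suc (μ * 2 + (μ * 2 + k₀ * l)))
  n≡ = cong suc (+-suc (μ * 2) _)

even-or-odd : ∀ m → ∃ λ h → m ≡ h * 2 ⊎ m ≡ suc (h * 2)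
even-or-odd m with m % 2 | m%n<n m 2 | m≡m%n+[m/n]*n m 2
... | 0 | _ | eq = m / 2 , inj₁ eq
... | 1 | _ | eq = m / 2 , inj₂ eq
... | suc (suc _) | s≤s (s≤s ()) | _

theorem5p6 : (l k : ℕ) → l % 2 ≡ 1 → 4 ≤ k →
    Σ (Config (k * l)) λ x → Independent x ×
    Σ ℕ λ T → IsScrollPeriod x T × IsCyclicPeriod (k * l) (sumVec x T) l
theorem5p6 l k odd 4≤k = subst (λ l → HasScroll (k * l) l) (sym l≡) (by-parity (m≤n⇒∃[o]m+o≡n 4≤k))
  where
  μ = l / 2
  l≡ : l ≡ suc (μ * 2)
  l≡ = trans (m≡m%n+[m/n]*n l 2) (cong (_+ μ * 2) odd)
  by-parity : (∃ λ m → 4 + m ≡ k) → HasScroll (k * suc (μ * 2)) (suc (μ * 2))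
  by-parity (m , refl) with even-or-odd m
  ... | h , inj₁ refl = word⇒hasScroll μ (2 + h * 2) (evenWord μ h) (evenWord-length μ h) (evenWord-separatesTop μ h)
  ... | h , inj₂ refl = word⇒hasScroll μ (3 + h * 2) (oddWord μ h) (oddWord-length μ h) (oddWord-separatesTop μ h)
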